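{- Let $R$ be a commutative ring with unity and let $n\ge 2$ be an integer. Let \[S_1=\{\,x_0^8+2x_1^4+4x_2^2 \pmod{8R} \;:\; x_0,x_1,x_2\in R\,\}\subseteq R/8R.\] Then a matrix $M\in M_n(R)$ is a sum of eighth powers of matrices in $M_n(R)$ (i.e., $M=\sum_{i=1}^r M_i^8$ for some $r\ge 1$ and $M_i\in M_n(R)$) if and only if $\operatorname{Tr} M\pmod{8R}\in S_1$.
   Context: $\operatorname{Tr}$ denotes the trace; $x\pmod{8R}$ denotes the image of $x\in R$ in $R/8R$. -}

module Defs where

open import Level using (_⊔_)
open import Algebra.Bundles using (CommutativeRing)
open import Data.Nat using (ℕ; zero; suc)
open import Data.Fin using (Fin; zero; suc)
open import Data.Product using (Σ; ∃; _×_; _,_)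
open import Relation.Nullary using (Dec; yes; no)
open import Data.Fin using (_≟_)

module MatrixDefs {c ℓ} (R : CommutativeRing c ℓ) where
  open CommutativeRing R using (Carrier; _≈_; _+_; _*_; 0#; 1#)

  pow : Carrier → ℕ → Carrier
  pow x zero = 1#
  pow x (suc k) = x * pow x k

  nat : ℕ → Carrier
  nat zero = 0#
  nat (suc k) = 1# + nat k

  sumFin : (n : ℕ) → (Fin n → Carrier) → Carrier
  sumFin zero f = 0#
  sumFin (suc n) f = f zero + sumFin n (λ i → f (suc i))

  Mat : ℕ → Set c
  Mat n = Fin n → Fin n → Carrier

  _≋_ : {n : ℕ} → Mat n → Mat n → Set ℓ
  A ≋ B = ∀ i j → A i j ≈ B i j

  _⊕_ : {n : ℕ} → Mat n → Mat n → Mat n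
  (A ⊕ B) i j = A i j + B i j

  _⊗_ : {n : ℕ} → Mat n → Mat n → Mat n
  _⊗_ {n} A B i j = sumFin n (λ k → A i k * B k j)

  zeroM : {n : ℕ} → Mat n
  zeroM i j = 0#

  idM : {n : ℕ} → Mat n
  idM i j with i ≟ j
  ... | yes _ = 1#
  ... | no _ = 0#

  powM : {n : ℕ} → Mat n → ℕ → Mat n
  powM A zero = idM
  powM A (suc k) = A ⊗ powM A k

  sumM : {n : ℕ} (r : ℕ) → (Fin r → Mat n) → Mat n
  sumM zero Ms = zeroM
  sumM (suc r) Ms = Ms zero ⊕ sumM r (λ i → Ms (suc i))

  trace : {n : ℕ} → Mat n → Carrier
  trace {n} A = sumFin n (λ i → A i i)

  IsSumOfEighthPowers : {n : ℕ} → Mat n → Set (c ⊔ ℓ)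
  IsSumOfEighthPowers {n} M =
    Σ ℕ λ r → Σ (Fin (suc r) → Mat n) λ Ms → M ≋ sumM (suc r) (λ i → powM (Ms i) 8)

  InS₁mod8 : Carrier → Set (c ⊔ ℓ)
  InS₁mod8 t = Σ Carrier λ x₀ → Σ Carrier λ x₁ → Σ Carrier λ x₂ → Σ Carrier λ y →
    t ≈ (pow x₀ 8 + nat 2 * pow x₁ 4 + nat 4 * pow x₂ 2) + nat 8 * y

{-# OPTIONS --safe #-}

-- Necessity: S₁ is closed under addition, so it suffices to treat Tr A⁸.  Write A as
-- a sum of n rank-one matrices.  Adding u vᵀ to B changes Tr B⁸ by the power-sum
-- polynomial p₈(s₀, …, s₇) of the numbers s_j = vᵀ Bʲ u, and p₈ always lies in S₁.
--
-- Sufficiency: rank-one idempotents are their own eighth powers, and −e₀₀ is a sum of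
-- eighth powers because W⁸ + W′⁸ = −2e₀₀ for two matrices of order 3.  These generate
-- all matrices of trace zero, so only Tr M matters, and the admissible traces form an
-- additive set T containing every Tr A⁸.  The traces of eighth powers of 2×2 matrices
-- of trace a and determinant −b then give ±a⁸, ±2a⁴, ±4a² and 8a in T successively.
module Submission where

open import Defs
open import Algebra.Bundles using (CommutativeRing)
open import Algebra.Solver.Ring.AlmostCommutativeRing
  using (fromCommutativeRing; _-Raw-AlmostCommutative⟶_)
open import Data.Fin using (Fin; zero; suc; _≟_)
open import Data.Integer as ℤ using (ℤ; +_; -[1+_]; _⊖_; _◃_)
import Data.Integer.Properties as ℤ
open import Data.Maybe using (Maybe; just; nothing)
open import Data.Nat as ℕ using (ℕ; zero; suc; _≤_; z≤n; s≤s)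
import Data.Nat.Properties as ℕ
open import Data.Product using (Σ; _×_; _,_; proj₁; proj₂)
import Data.Sign as Sign
open import Data.List using (List; []; _∷_)
open import Relation.Binary.PropositionalEquality as ≡ using (_≡_)
open import Relation.Nullary using (yes; no)
import Algebra.Solver.Ring

-- For A = u vᵀ + B and s j = vᵀ Bʲ u, passage s j k is vᵀ Bʲ Aᵏ u and
-- traceGain s j k is Tr (Aᵏ Bʲ) − Tr Bᵏ⁺ʲ.  The operations are parameters because
-- the same recursion is run on ring elements and on solver polynomials.
module RankOneUpdate {a} {A : Set a} (_+_ _*_ : A → A → A) (0# : A) where

  passage : (ℕ → A) → ℕ → ℕ → A
  passage s j zero = s j
  passage s j (suc k) = passage s (suc j) k + (s j * passage s 0 k)

  traceGain : (ℕ → A) → ℕ → ℕ → A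
  traceGain s j zero = 0#
  traceGain s j (suc k) = traceGain s (suc j) k + passage s j k

  fromList : List A → ℕ → A
  fromList [] _ = 0#
  fromList (x ∷ xs) zero = x
  fromList (x ∷ xs) (suc i) = fromList xs i

-- Quadruples list 2×2 matrices by rows. As above, the operations are parameters so that solver
-- polynomials can be squared by the same formula.
module Square₂ {a} {A : Set a} (_+_ _*_ : A → A → A) where

  square : A × A × A × A → A × A × A × A
  square (a , b , c , d) =
    (a * a) + (b * c) , (a * b) + (b * d) , (c * a) + (d * c) , (c * b) + (d * d)

module EighthPowers {c ℓ} (R : CommutativeRing c ℓ) where
  open CommutativeRing R hiding (zero)
  open MatrixDefs R
  open import Algebra.Properties.Ring ring
    using (-‿distribˡ-*; -‿distribʳ-*; -0#≈0#; -‿involutive; -‿+-comm)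
  open import Algebra.Properties.CommutativeSemigroup +-commutativeSemigroup
    using (interchange)
  open import Relation.Binary.Reasoning.Setoid setoid

  -- Integer coefficients for the ring solver

  nat-+ : ∀ m n → nat (m ℕ.+ n) ≈ nat m + nat n
  nat-+ zero n = sym (+-identityˡ _)
  nat-+ (suc m) n = trans (+-congˡ (nat-+ m n)) (sym (+-assoc _ _ _))

  nat-* : ∀ m n → nat (m ℕ.* n) ≈ nat m * nat n
  nat-* zero n = sym (zeroˡ _)
  nat-* (suc m) n = begin
    nat (n ℕ.+ m ℕ.* n)            ≈⟨ nat-+ n (m ℕ.* n) ⟩
    nat n + nat (m ℕ.* n)          ≈⟨ +-cong (sym (*-identityˡ _)) (nat-* m n) ⟩
    1# * nat n + nat m * nat n     ≈⟨ distribʳ _ _ _ ⟨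
    (1# + nat m) * nat n           ∎

  int : ℤ → Carrier
  int (+ n) = nat n
  int -[1+ n ] = - nat (suc n)

  int-⊖ : ∀ m n → int (m ⊖ n) ≈ nat m + - nat n
  int-⊖ m zero = sym (trans (+-congˡ -0#≈0#) (+-identityʳ _))
  int-⊖ zero (suc n) = sym (+-identityˡ _)
  int-⊖ (suc m) (suc n) = begin
    int (suc m ⊖ suc n)                ≡⟨ ≡.cong int (ℤ.[1+m]⊖[1+n]≡m⊖n m n) ⟩
    int (m ⊖ n)                        ≈⟨ int-⊖ m n ⟩
    nat m + - nat n                    ≈⟨ +-identityˡ _ ⟨
    0# + (nat m + - nat n)             ≈⟨ +-congʳ (-‿inverseʳ 1#) ⟨
    (1# + - 1#) + (nat m + - nat n)    ≈⟨ interchange _ _ _ _ ⟩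
    (1# + nat m) + (- 1# + - nat n)    ≈⟨ +-congˡ (-‿+-comm _ _) ⟩
    (1# + nat m) + - (1# + nat n)      ∎

  int-+ : ∀ i j → int (i ℤ.+ j) ≈ int i + int j
  int-+ (+ m) (+ n) = nat-+ m n
  int-+ (+ m) -[1+ n ] = int-⊖ m (suc n)
  int-+ -[1+ m ] (+ n) = trans (int-⊖ n (suc m)) (+-comm _ _)
  int-+ -[1+ m ] -[1+ n ] = begin
    - nat (suc (suc (m ℕ.+ n)))        ≈⟨ -‿cong (+-congˡ (nat-+ (suc m) n)) ⟩
    - (1# + (nat (suc m) + nat n))     ≈⟨ -‿cong (trans (sym (+-assoc _ _ _)) (trans (+-congʳ (+-comm _ _)) (+-assoc _ _ _))) ⟩
    - (nat (suc m) + nat (suc n))      ≈⟨ -‿+-comm _ _ ⟨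
    - nat (suc m) + - nat (suc n)      ∎

  int-+◃ : ∀ n → int (Sign.+ ◃ n) ≈ nat n
  int-+◃ zero = refl
  int-+◃ (suc n) = refl

  int--◃ : ∀ n → int (Sign.- ◃ n) ≈ - nat n
  int--◃ zero = sym -0#≈0#
  int--◃ (suc n) = refl

  int-* : ∀ i j → int (i ℤ.* j) ≈ int i * int j
  int-* (+ m) (+ n) = trans (int-+◃ (m ℕ.* n)) (nat-* m n)
  int-* (+ m) -[1+ n ] = begin
    int (Sign.- ◃ (m ℕ.* suc n))  ≈⟨ int--◃ (m ℕ.* suc n) ⟩
    - nat (m ℕ.* suc n)           ≈⟨ -‿cong (nat-* m (suc n)) ⟩
    - (nat m * nat (suc n))       ≈⟨ -‿distribʳ-* _ _ ⟩
    nat m * - nat (suc n)         ∎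
  int-* -[1+ m ] (+ n) = begin
    int (Sign.- ◃ (suc m ℕ.* n))  ≈⟨ int--◃ (suc m ℕ.* n) ⟩
    - nat (suc m ℕ.* n)           ≈⟨ -‿cong (nat-* (suc m) n) ⟩
    - (nat (suc m) * nat n)       ≈⟨ -‿distribˡ-* _ _ ⟩
    - nat (suc m) * nat n         ∎
  int-* -[1+ m ] -[1+ n ] = begin
    nat (suc m ℕ.* suc n)             ≈⟨ nat-* (suc m) (suc n) ⟩
    nat (suc m) * nat (suc n)         ≈⟨ -‿involutive _ ⟨
    - - (nat (suc m) * nat (suc n))   ≈⟨ -‿cong (-‿distribˡ-* _ _) ⟩
    - (- nat (suc m) * nat (suc n))   ≈⟨ -‿distribʳ-* _ _ ⟩
    - nat (suc m) * - nat (suc n)     ∎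

  int-- : ∀ i → int (ℤ.- i) ≈ - int i
  int-- (+ zero) = sym -0#≈0#
  int-- (+ suc n) = refl
  int-- -[1+ n ] = sym (-‿involutive _)

  -- Equality in `R` need not be decidable, so the solver normalises with coefficients in ℤ. Since
  -- `int (+ k)` is `nat k` by definition, solver constants agree with the numerals of the
  -- statement.
  int-homomorphism : ℤ.+-*-rawRing -Raw-AlmostCommutative⟶ fromCommutativeRing R
  int-homomorphism = record
    { ⟦_⟧ = int
    ; +-homo = int-+
    ; *-homo = int-*
    ; -‿homo = int--
    ; 0-homo = refl
    ; 1-homo = +-identityʳ 1#
    }

  int≟ : ∀ i j → Maybe (int i ≈ int j)
  int≟ i j with i ℤ.≟ j
  ... | yes ≡.refl = just refl
  ... | no _ = nothing

  open Algebra.Solver.Ring ℤ.+-*-rawRing (fromCommutativeRing R) int-homomorphism int≟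
    using (Polynomial; con; _:^_; :-_; _:+_; _:*_; _:-_; _:=_; solve)

  open RankOneUpdate _+_ _*_ 0#

  :nat : ∀ {m} → ℕ → Polynomial m
  :nat k = con (+ k)

  private
    module P {m} = RankOneUpdate {A = Polynomial m} _:+_ _:*_ (:nat 0)

  -- Closure of S₁ under addition

  S₁-resp-≈ : ∀ {t u} → t ≈ u → InS₁mod8 t → InS₁mod8 u
  S₁-resp-≈ t≈u (x₀ , x₁ , x₂ , y , eq) = x₀ , x₁ , x₂ , y , trans (sym t≈u) eq

  S₁-0 : InS₁mod8 0#
  S₁-0 = 0# , 0# , 0# , 0# ,
    solve 0 (let z = :nat 0 in z := z :^ 8 :+ :nat 2 :* z :^ 4 :+ :nat 4 :* z :^ 2 :+ :nat 8 :* z) refl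

  S₁-+8 : ∀ {t} z → InS₁mod8 t → InS₁mod8 (t + nat 8 * z)
  S₁-+8 z (x₀ , x₁ , x₂ , y , eq) = x₀ , x₁ , x₂ , y + z ,
    trans (+-congʳ eq)
      (solve 3 (λ s y z → s :+ :nat 8 :* y :+ :nat 8 :* z := s :+ :nat 8 :* (y :+ z)) refl _ y z)

  -- The cross term of 4(x₂ + z)² is 8x₂z, which the multiple of 8 absorbs.
  S₁-+4² : ∀ {t} z → InS₁mod8 t → InS₁mod8 (t + nat 4 * pow z 2)
  S₁-+4² z (x₀ , x₁ , x₂ , y , eq) = x₀ , x₁ , x₂ + z , y - x₂ * z ,
    trans (+-congʳ eq)
      (solve 4 (λ s x₂ y z →
          s :+ :nat 4 :* x₂ :^ 2 :+ :nat 8 :* y :+ :nat 4 :* z :^ 2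
        := s :+ :nat 4 :* (x₂ :+ z) :^ 2 :+ :nat 8 :* (y :- x₂ :* z))
        refl _ x₂ y z)

  -- Modulo 8 the only surviving cross term of 2(x₁ + z)⁴ is 12x₁²z², which is -4(x₁z)². It is
  -- compensated by adding a square through `S₁-+4²`.
  S₁-+2⁴ : ∀ {t} z → InS₁mod8 t → InS₁mod8 (t + nat 2 * pow z 4)
  S₁-+2⁴ z (x₀ , x₁ , x₂ , y , eq) =
    S₁-resp-≈
      (sym (trans (+-congʳ eq)
        (solve 5 (λ x₀ x₁ x₂ y z →
            x₀ :^ 8 :+ :nat 2 :* x₁ :^ 4 :+ :nat 4 :* x₂ :^ 2 :+ :nat 8 :* y :+ :nat 2 :* z :^ 4
          := (x₀ :^ 8 :+ :nat 2 :* (x₁ :+ z) :^ 4 :+ :nat 4 :* x₂ :^ 2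
               :+ :nat 8 :* (y :- (x₁ :^ 3 :* z :+ :nat 2 :* x₁ :^ 2 :* z :^ 2 :+ x₁ :* z :^ 3)))
             :+ :nat 4 :* (x₁ :* z) :^ 2)
          refl x₀ x₁ x₂ y z)))
      (S₁-+4² (x₁ * z) (x₀ , x₁ + z , x₂ , _ , refl))

  -- Modulo 8 the cross terms of (x₀ + z)⁸ are 4x₀⁶z² + 6x₀⁴z⁴ + 4x₀²z⁶. Adding 4(x₀³z + x₀z³)² +
  -- 2(x₀z)⁴ cancels them, and both corrections are of types already handled.
  S₁-+⁸ : ∀ {t} z → InS₁mod8 t → InS₁mod8 (t + pow z 8)
  S₁-+⁸ z (x₀ , x₁ , x₂ , y , eq) =
    S₁-resp-≈
      (sym (trans (+-congʳ eq)
        (solve 5 (λ x₀ x₁ x₂ y z →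
            x₀ :^ 8 :+ :nat 2 :* x₁ :^ 4 :+ :nat 4 :* x₂ :^ 2 :+ :nat 8 :* y :+ z :^ 8
          := (x₀ :+ z) :^ 8 :+ :nat 2 :* x₁ :^ 4 :+ :nat 4 :* x₂ :^ 2
               :+ :nat 8 :* (y :- (x₀ :^ 7 :* z :+ :nat 4 :* x₀ :^ 6 :* z :^ 2
                 :+ :nat 7 :* x₀ :^ 5 :* z :^ 3 :+ :nat 10 :* x₀ :^ 4 :* z :^ 4
                 :+ :nat 7 :* x₀ :^ 3 :* z :^ 5 :+ :nat 4 :* x₀ :^ 2 :* z :^ 6
                 :+ x₀ :* z :^ 7))
             :+ :nat 4 :* (x₀ :^ 3 :* z :+ x₀ :* z :^ 3) :^ 2
             :+ :nat 2 :* (x₀ :* z) :^ 4)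
          refl x₀ x₁ x₂ y z)))
      (S₁-+2⁴ (x₀ * z) (S₁-+4² (pow x₀ 3 * z + x₀ * pow z 3) (x₀ + z , x₁ , x₂ , _ , refl)))

  S₁-+ : ∀ {t u} → InS₁mod8 t → InS₁mod8 u → InS₁mod8 (t + u)
  S₁-+ {t} t∈S₁ (x₀ , x₁ , x₂ , y , eq) =
    S₁-resp-≈
      (trans
        (solve 5 (λ t a b c d → t :+ a :+ b :+ c :+ d := t :+ (a :+ b :+ c :+ d)) refl t _ _ _ _)
        (+-congˡ (sym eq)))
      (S₁-+8 y (S₁-+4² x₂ (S₁-+2⁴ x₁ (S₁-+⁸ x₀ t∈S₁))))

  -- traceGain s 0 8 is the sum over cyclic compositions of 8 of (period · monomial):
  -- periods 1, 2 and 4 give the summands of S₁, and the multiple of 8 collects the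
  -- aperiodic ones less the cross terms of the square.
  traceGain₈∈S₁ : ∀ s → InS₁mod8 (traceGain s 0 8)
  traceGain₈∈S₁ s = s 0 , s 1 , s 0 * s 0 * s 1 + s 0 * s 2 + s 3 , _ ,
    solve 8 (λ a b c d e f g h →
        P.traceGain (P.fromList (a ∷ b ∷ c ∷ d ∷ e ∷ f ∷ g ∷ h ∷ [])) 0 8
      := a :^ 8 :+ :nat 2 :* b :^ 4 :+ :nat 4 :* (a :* a :* b :+ a :* c :+ d) :^ 2
         :+ :nat 8 :*
           (h :+ a :* g :+ b :* f :+ a :* a :* f :+ c :* e :+ :nat 2 :* a :* b :* e
             :+ a :* a :* a :* e :+ a :* c :* d :+ b :* b :* d :+ :nat 2 :* a :* a :* b :* d
             :+ a :* a :* a :* a :* d :+ b :* c :* c :+ a :* a :* c :* c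
             :+ :nat 3 :* a :* b :* b :* c :+ :nat 3 :* a :* a :* a :* b :* c
             :+ a :* a :* a :* a :* a :* c :+ :nat 2 :* a :* a :* b :* b :* b
             :+ :nat 2 :* a :* a :* a :* a :* b :* b :+ a :* a :* a :* a :* a :* a :* b))
      refl (s 0) (s 1) (s 2) (s 3) (s 4) (s 5) (s 6) (s 7)

  -- Additive sets containing the 2×2 traces

  -- Tr C⁸ for a 2×2 matrix C of trace a and determinant −b.
  trace₂ : Carrier → Carrier → Carrier
  trace₂ a b = traceGain (fromList (a ∷ b ∷ [])) 0 8

  private
    :trace₂ : ∀ {m} → Polynomial m → Polynomial m → Polynomial m
    :trace₂ a b = P.traceGain (P.fromList (a ∷ b ∷ [])) 0 8

  -- Closure of `T` under negation is not among the hypotheses, so the negative of each generator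
  -- has to be produced separately.
  module AdditiveClosure {p} (T : Carrier → Set p)
    (resp : ∀ {t u} → t ≈ u → T t → T u) (zero∈ : T 0#)
    (+∈ : ∀ {t u} → T t → T u → T (t + u)) (trace₂∈ : ∀ a b → T (trace₂ a b)) where

    multiple : ∀ k {t} → T t → T (nat k * t)
    multiple zero t∈ = resp (sym (zeroˡ _)) zero∈
    multiple (suc k) {t} t∈ =
      resp (trans (+-congʳ (sym (*-identityˡ t))) (sym (distribʳ t 1# (nat k))))
        (+∈ t∈ (multiple k t∈))

    ⁸∈ : ∀ x → T (pow x 8)
    ⁸∈ x = resp (solve 1 (λ x → :trace₂ x (:nat 0) := x :^ 8) refl x) (trace₂∈ x 0#)

    -- Here the eigenvalues are −ωx and −ω²x with ω a primitive cube root of unity.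
    -⁸∈ : ∀ x → T (- pow x 8)
    -⁸∈ x = resp (solve 1 (λ x → :trace₂ x (:- (x :* x)) := :- (x :^ 8)) refl x)
      (trace₂∈ x (- (x * x)))

    -1∈ : T (- nat 1)
    -1∈ = resp (solve 0 (:- (:nat 1 :^ 8) := :- :nat 1) refl) (-⁸∈ (nat 1))

    -- A 2×2 matrix of trace 0 and determinant -x squares to the scalar x, so its eighth power is
    -- the scalar x⁴.
    2⁴∈ : ∀ x → T (nat 2 * pow x 4)
    2⁴∈ x = resp (solve 1 (λ x → :trace₂ (:nat 0) x := :nat 2 :* x :^ 4) refl x) (trace₂∈ 0# x)

    -- trace₂ x (−2x² − e) = 2e⁴ − 28x⁴e² − 56x⁶e − 31x⁸, taken at e = ±1.
    -2⁴∈ : ∀ x → T (- (nat 2 * pow x 4))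
    -2⁴∈ x = resp
      (solve 1 (λ x →
          :trace₂ x (:- (:nat 2 :* x :* x) :- :nat 1) :+ :trace₂ x (:- (:nat 2 :* x :* x) :+ :nat 1)
            :+ :nat 62 :* x :^ 8 :+ :nat 27 :* (:nat 2 :* x :^ 4) :+ :nat 4 :* (:- :nat 1)
        := :- (:nat 2 :* x :^ 4)) refl x)
      (+∈ (+∈ (+∈ (+∈ (trace₂∈ _ _) (trace₂∈ _ _)) (multiple 62 (⁸∈ x))) (multiple 27 (2⁴∈ x)))
        (multiple 4 -1∈))

    -- The second difference of 2x⁴ with step 1 is 24x² + 4.
    24²∈ : ∀ x → T (nat 24 * pow x 2)
    24²∈ x = resp
      (solve 1 (λ x →
          :nat 2 :* (x :+ :nat 1) :^ 4 :+ :nat 2 :* (x :- :nat 1) :^ 4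
            :+ :nat 2 :* (:- (:nat 2 :* x :^ 4)) :+ :nat 4 :* (:- :nat 1)
        := :nat 24 :* x :^ 2) refl x)
      (+∈ (+∈ (+∈ (2⁴∈ _) (2⁴∈ _)) (multiple 2 (-2⁴∈ x))) (multiple 4 -1∈))

    -- Trace 1 and determinant 1 + x give 2x⁴ - 8x³ - 16x² - 8x - 1. Subtracting 2(x - 1)⁴ removes
    -- every term of degree 1, 3 and 4 and leaves -28x² - 3.
    -4²∈ : ∀ x → T (- (nat 4 * pow x 2))
    -4²∈ x = resp
      (solve 1 (λ x →
          :trace₂ (:nat 1) (:- (:nat 1 :+ x)) :+ (:- (:nat 2 :* (x :- :nat 1) :^ 4))
            :+ :nat 24 :* x :^ 2 :+ :nat 3 :* :nat 1 :^ 8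
        := :- (:nat 4 :* x :^ 2)) refl x)
      (+∈ (+∈ (+∈ (trace₂∈ _ _) (-2⁴∈ _)) (24²∈ x)) (multiple 3 (⁸∈ (nat 1))))

    4²∈ : ∀ x → T (nat 4 * pow x 2)
    4²∈ x = resp
      (solve 1 (λ x →
          :nat 5 :* (:- (:nat 4 :* x :^ 2)) :+ :nat 24 :* x :^ 2 := :nat 4 :* x :^ 2) refl x)
      (+∈ (multiple 5 (-4²∈ x)) (24²∈ x))

    -- Polarisation: the first difference of 4x² is 8x + 4.
    8∈ : ∀ x → T (nat 8 * x)
    8∈ x = resp
      (solve 1 (λ x →
          :nat 4 :* (x :+ :nat 1) :^ 2 :+ (:- (:nat 4 :* x :^ 2)) :+ (:- (:nat 4 :* :nat 1 :^ 2))
        := :nat 8 :* x) refl x)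
      (+∈ (+∈ (4²∈ _) (-4²∈ x)) (-4²∈ _))

    S₁⊆ : ∀ {t} → InS₁mod8 t → T t
    S₁⊆ (x₀ , x₁ , x₂ , y , eq) =
      resp (sym eq) (+∈ (+∈ (+∈ (⁸∈ x₀) (2⁴∈ x₁)) (4²∈ x₂)) (8∈ y))

  -- Finite sums, dot products and matrix powers

  open import Algebra.Properties.CommutativeMonoid.Sum +-commutativeMonoid
    using (sum; sum-cong-≋; sum-replicate-zero; ∑-distrib-+; ∑-comm)
  open import Algebra.Properties.Semiring.Sum semiring using (*-distribˡ-sum; *-distribʳ-sum)

  sumFin≡sum : ∀ n (f : Fin n → Carrier) → sumFin n f ≡ sum f
  sumFin≡sum zero f = ≡.refl
  sumFin≡sum (suc n) f = ≡.cong₂ _+_ ≡.refl (sumFin≡sum n (λ i → f (suc i)))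

  private
    variable
      n : ℕ

  sumFin-cong : ∀ n {f g : Fin n → Carrier} → (∀ i → f i ≈ g i) → sumFin n f ≈ sumFin n g
  sumFin-cong n {f} {g} f≈g rewrite sumFin≡sum n f | sumFin≡sum n g = sum-cong-≋ f≈g

  sumFin-0 : ∀ n {f : Fin n → Carrier} → (∀ i → f i ≈ 0#) → sumFin n f ≈ 0#
  sumFin-0 n {f} f≈0 rewrite sumFin≡sum n f = trans (sum-cong-≋ f≈0) (sum-replicate-zero n)

  sumFin-+ : ∀ n (f g : Fin n → Carrier) → sumFin n (λ i → f i + g i) ≈ sumFin n f + sumFin n g
  sumFin-+ n f g
    rewrite sumFin≡sum n (λ i → f i + g i) | sumFin≡sum n f | sumFin≡sum n g = ∑-distrib-+ f g

  sumFin-*ˡ : ∀ n x (f : Fin n → Carrier) → x * sumFin n f ≈ sumFin n (λ i → x * f i)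
  sumFin-*ˡ n x f rewrite sumFin≡sum n f | sumFin≡sum n (λ i → x * f i) = *-distribˡ-sum x f

  sumFin-*ʳ : ∀ n x (f : Fin n → Carrier) → sumFin n f * x ≈ sumFin n (λ i → f i * x)
  sumFin-*ʳ n x f rewrite sumFin≡sum n f | sumFin≡sum n (λ i → f i * x) = *-distribʳ-sum x f

  sumFin-neg : ∀ n (f : Fin n → Carrier) → sumFin n (λ i → - f i) ≈ - sumFin n f
  sumFin-neg zero f = sym -0#≈0#
  sumFin-neg (suc n) f = trans (+-congˡ (sumFin-neg n (λ i → f (suc i)))) (-‿+-comm _ _)

  sumFin-comm : ∀ m n (f : Fin m → Fin n → Carrier) →
    sumFin m (λ i → sumFin n (f i)) ≈ sumFin n (λ j → sumFin m (λ i → f i j))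
  sumFin-comm m n f = begin
    sumFin m (λ i → sumFin n (f i))          ≈⟨ sumFin-cong m (λ i → reflexive (sumFin≡sum n (f i))) ⟩
    sumFin m (λ i → sum (f i))               ≡⟨ sumFin≡sum m _ ⟩
    sum (λ i → sum (f i))                    ≈⟨ ∑-comm f ⟩
    sum (λ j → sum (λ i → f i j))            ≡⟨ sumFin≡sum n _ ⟨
    sumFin n (λ j → sum (λ i → f i j))       ≈⟨ sumFin-cong n (λ j → reflexive (sumFin≡sum m (λ i → f i j))) ⟨
    sumFin n (λ j → sumFin m (λ i → f i j))  ∎

  Vec : ℕ → Set c
  Vec n = Fin n → Carrier

  infix 8 _∙_
  _∙_ : Vec n → Vec n → Carrier
  _∙_ {n} u v = sumFin n (λ i → u i * v i)

  infixr 9 _*ᵥ_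
  infixl 9 _ᵥ*_
  _*ᵥ_ : Mat n → Vec n → Vec n
  (A *ᵥ w) i = A i ∙ w

  _ᵥ*_ : Vec n → Mat n → Vec n
  (v ᵥ* A) j = v ∙ (λ i → A i j)

  outer : Vec n → Vec n → Mat n
  outer u v i j = u i * v j

  ∙-cong : ∀ {u u′ v v′ : Vec n} → (∀ i → u i ≈ u′ i) → (∀ i → v i ≈ v′ i) → u ∙ v ≈ u′ ∙ v′
  ∙-cong {n} p q = sumFin-cong n (λ i → *-cong (p i) (q i))

  -- The two summations are interchanged. Entries of `A ⊗ B` are dot products by definition, so
  -- associativity of `_⊗_` is an instance.
  ∙-assoc : ∀ (v : Vec n) A w → (v ᵥ* A) ∙ w ≈ v ∙ (A *ᵥ w)
  ∙-assoc {n} v A w = begin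
    sumFin n (λ j → sumFin n (λ i → v i * A i j) * w j)    ≈⟨ sumFin-cong n (λ j → sumFin-*ʳ n (w j) _) ⟩
    sumFin n (λ j → sumFin n (λ i → v i * A i j * w j))    ≈⟨ sumFin-comm n n _ ⟩
    sumFin n (λ i → sumFin n (λ j → v i * A i j * w j))    ≈⟨ sumFin-cong n (λ i → sumFin-cong n (λ j → *-assoc _ _ _)) ⟩
    sumFin n (λ i → sumFin n (λ j → v i * (A i j * w j)))  ≈⟨ sumFin-cong n (λ i → sumFin-*ˡ n (v i) _) ⟨
    sumFin n (λ i → v i * sumFin n (λ j → A i j * w j))    ∎

  ∙-distribʳ : ∀ (u v w : Vec n) → (λ i → u i + v i) ∙ w ≈ u ∙ w + v ∙ w
  ∙-distribʳ {n} u v w = trans (sumFin-cong n (λ i → distribʳ _ _ _)) (sumFin-+ n _ _)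

  ∙-distribˡ : ∀ (u v w : Vec n) → u ∙ (λ i → v i + w i) ≈ u ∙ v + u ∙ w
  ∙-distribˡ {n} u v w = trans (sumFin-cong n (λ i → distribˡ _ _ _)) (sumFin-+ n _ _)

  ∙-scaleʳ : ∀ (u v : Vec n) x → u ∙ (λ i → v i * x) ≈ u ∙ v * x
  ∙-scaleʳ {n} u v x = trans (sumFin-cong n (λ i → sym (*-assoc _ _ _))) (sym (sumFin-*ʳ n x _))

  ∙-scaleˡ : ∀ x (u v : Vec n) → (λ i → x * u i) ∙ v ≈ x * u ∙ v
  ∙-scaleˡ {n} x u v = trans (sumFin-cong n (λ i → *-assoc _ _ _)) (sym (sumFin-*ˡ n x _))

  idM-suc : ∀ (i j : Fin n) → idM (suc i) (suc j) ≡ idM i j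
  idM-suc i j with i ≟ j
  ... | yes _ = ≡.refl
  ... | no _ = ≡.refl

  idM-∙ : ∀ (i : Fin n) w → idM i ∙ w ≈ w i
  idM-∙ {suc n} zero w = trans (+-cong (*-identityˡ _) (sumFin-0 n (λ j → zeroˡ _))) (+-identityʳ _)
  idM-∙ (suc i) w = begin
    0# * w zero + (λ j → idM (suc i) (suc j)) ∙ (λ j → w (suc j))
      ≈⟨ +-cong (zeroˡ _) (∙-cong (λ j → reflexive (idM-suc i j)) (λ j → refl)) ⟩
    0# + idM i ∙ (λ j → w (suc j))
      ≈⟨ trans (+-identityˡ _) (idM-∙ i _) ⟩
    w (suc i) ∎

  ∙-idM : ∀ (j : Fin n) v → v ∙ (λ i → idM i j) ≈ v j
  ∙-idM {suc n} zero v = trans (+-cong (*-identityʳ _) (sumFin-0 n (λ j → zeroʳ _))) (+-identityʳ _)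
  ∙-idM (suc j) v = begin
    v zero * 0# + (λ i → v (suc i)) ∙ (λ i → idM (suc i) (suc j))
      ≈⟨ +-cong (zeroʳ _) (∙-cong {u = λ i → v (suc i)} (λ i → refl) (λ i → reflexive (idM-suc i j))) ⟩
    0# + (λ i → v (suc i)) ∙ (λ i → idM i j)
      ≈⟨ trans (+-identityˡ _) (∙-idM j _) ⟩
    v (suc j) ∎

  ⊗-cong : ∀ {A A′ B B′ : Mat n} → A ≋ A′ → B ≋ B′ → (A ⊗ B) ≋ (A′ ⊗ B′)
  ⊗-cong p q i j = ∙-cong (p i) (λ k → q k j)

  ⊗-assoc : ∀ (A B C : Mat n) → ((A ⊗ B) ⊗ C) ≋ (A ⊗ (B ⊗ C))
  ⊗-assoc A B C i j = ∙-assoc (A i) B (λ k → C k j)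

  powM-cong : ∀ {A B : Mat n} k → A ≋ B → powM A k ≋ powM B k
  powM-cong zero A≋B i j = refl
  powM-cong (suc k) A≋B = ⊗-cong A≋B (powM-cong k A≋B)

  powM-+ : ∀ (A : Mat n) k l → powM A (k ℕ.+ l) ≋ (powM A k ⊗ powM A l)
  powM-+ A zero l i j = sym (idM-∙ i _)
  powM-+ A (suc k) l i j =
    trans (⊗-cong {A = A} (λ _ _ → refl) (powM-+ A k l) i j) (sym (⊗-assoc A (powM A k) (powM A l) i j))

  powM-sucʳ : ∀ (A : Mat n) k → powM A (suc k) ≋ (powM A k ⊗ A)
  powM-sucʳ A zero i j = trans (∙-idM j (A i)) (sym (idM-∙ i _))
  powM-sucʳ A (suc k) i j =
    trans (⊗-cong {A = A} (λ _ _ → refl) (powM-sucʳ A k) i j) (sym (⊗-assoc A (powM A k) A i j))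

  -- Three squarings replace the eight-fold product, which keeps explicit computations small.
  powM-8 : ∀ {A B C D : Mat n} → (A ⊗ A) ≋ B → (B ⊗ B) ≋ C → (C ⊗ C) ≋ D → powM A 8 ≋ D
  powM-8 {A = A} {B} {C} A²≋B B²≋C C²≋D i j =
    trans (powM-+ A 4 4 i j) (trans (⊗-cong A⁴≋C A⁴≋C i j) (C²≋D i j))
    where
    A²≋B′ : powM A 2 ≋ B
    A²≋B′ i j = trans (⊗-cong {A = A} (λ _ _ → refl) (λ i j → ∙-idM j (A i)) i j) (A²≋B i j)
    A⁴≋C : powM A 4 ≋ C
    A⁴≋C i j = trans (powM-+ A 2 2 i j) (trans (⊗-cong A²≋B′ A²≋B′ i j) (B²≋C i j))

  zeroM-⊗ : ∀ (A : Mat n) → (zeroM ⊗ A) ≋ zeroM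
  zeroM-⊗ {n} A i j = sumFin-0 n (λ k → zeroˡ _)

  powM-zeroM : powM (zeroM {n}) 8 ≋ zeroM
  powM-zeroM i j = zeroM-⊗ (powM zeroM 7) i j

  trace-cong : ∀ {A B : Mat n} → A ≋ B → trace A ≈ trace B
  trace-cong {n} A≋B = sumFin-cong n (λ i → A≋B i i)

  trace-⊕ : ∀ (A B : Mat n) → trace (A ⊕ B) ≈ trace A + trace B
  trace-⊕ {n} A B = sumFin-+ n _ _

  sumM-entry : ∀ r (Ms : Fin r → Mat n) i j → sumM r Ms i j ≡ sumFin r (λ k → Ms k i j)
  sumM-entry zero Ms i j = ≡.refl
  sumM-entry (suc r) Ms i j = ≡.cong₂ _+_ ≡.refl (sumM-entry r (λ k → Ms (suc k)) i j)

  -- `idM k` serves as the k-th basis vector: a matrix is the sum of its columns times basis rows,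
  -- which is the rank-one decomposition used for necessity.
  sumM-columns : ∀ (M : Mat n) → M ≋ sumM n (λ k → outer (λ i → M i k) (idM k))
  sumM-columns {n} M i j = trans (sym (∙-idM j (M i))) (reflexive (≡.sym (sumM-entry n _ i j)))

  -- Change of Tr A⁸ under a rank-one update

  module _ {n} {A B : Mat n} {u v : Vec n} (A≋ : A ≋ (outer u v ⊕ B)) where

    s : ℕ → Carrier
    s j = (v ᵥ* powM B j) ∙ u

    private
      μ : ℕ → ℕ → Carrier
      μ j k = (v ᵥ* powM B j) ∙ (powM A k *ᵥ u)

    *ᵥ-update : ∀ w i → (A *ᵥ w) i ≈ u i * (v ∙ w) + (B *ᵥ w) i
    *ᵥ-update w i = begin
      A i ∙ w                                     ≈⟨ ∙-cong (A≋ i) (λ _ → refl) ⟩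
      (λ j → u i * v j + B i j) ∙ w               ≈⟨ ∙-distribʳ (λ j → u i * v j) (B i) w ⟩
      (λ j → u i * v j) ∙ w + B i ∙ w             ≈⟨ +-congʳ (∙-scaleˡ (u i) v w) ⟩
      u i * (v ∙ w) + B i ∙ w                     ∎

    ᵥ*-powM-suc : ∀ j i → (v ᵥ* powM B j ᵥ* B) i ≈ (v ᵥ* powM B (suc j)) i
    ᵥ*-powM-suc j i = trans (∙-assoc v (powM B j) (λ k → B k i))
      (∙-cong {u = v} (λ _ → refl) (λ k → sym (powM-sucʳ B j k i)))

    -- Splitting the leftmost factor of Aᵏ⁺¹ as u vᵀ + B gives vᵀBʲAᵏ⁺¹u = (vᵀBʲu)(vᵀAᵏu) +
    -- vᵀBʲ⁺¹Aᵏu, the recursion of `passage`.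
    passage-correct : ∀ j k → μ j k ≈ passage s j k
    passage-correct j zero = ∙-cong {u = v ᵥ* powM B j} (λ _ → refl) (λ i → idM-∙ i u)
    passage-correct j (suc k) = begin
      z ∙ (powM A (suc k) *ᵥ u)
        ≈⟨ ∙-cong {u = z} (λ _ → refl) (λ i → trans (∙-assoc (A i) (powM A k) u) (*ᵥ-update w i)) ⟩
      z ∙ (λ i → u i * (v ∙ w) + (B *ᵥ w) i)
        ≈⟨ ∙-distribˡ z (λ i → u i * (v ∙ w)) (B *ᵥ w) ⟩
      z ∙ (λ i → u i * (v ∙ w)) + z ∙ (B *ᵥ w)
        ≈⟨ +-cong (∙-scaleʳ z u _) (sym (∙-assoc z B w)) ⟩
      s j * (v ∙ w) + (z ᵥ* B) ∙ w
        -- Here `v` is rewritten as `v ᵥ* powM B 0`, so that `v ∙ w` becomes `μ 0 k`.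
        ≈⟨ +-cong (*-congˡ (∙-cong {v = w} (λ i → sym (∙-idM i v)) (λ _ → refl)))
                  (∙-cong {v = w} (ᵥ*-powM-suc j) (λ _ → refl)) ⟩
      s j * μ 0 k + μ (suc j) k
        ≈⟨ +-cong (*-congˡ (passage-correct 0 k)) (passage-correct (suc j) k) ⟩
      s j * passage s 0 k + passage s (suc j) k
        ≈⟨ +-comm _ _ ⟩
      passage s (suc j) k + s j * passage s 0 k ∎
      where
      z w : Vec n
      z = v ᵥ* powM B j
      w = powM A k *ᵥ u

    trace-outer : ∀ (X Y : Mat n) →
      trace (X ⊗ (λ i → λ j → u i * (v ᵥ* Y) j)) ≈ (v ᵥ* Y) ∙ (X *ᵥ u)
    trace-outer X Y = sumFin-cong n (λ i → trans (∙-scaleʳ (X i) u _) (*-comm _ _))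

    -- The factors A are turned into B one at a time from the right. Each replacement costs Tr(Aᵏ u
    -- vᵀBʲ) = vᵀBʲAᵏu, so cyclicity of the trace enters only for a rank-one factor.
    trace-powM-⊗ : ∀ k j → trace (powM A k ⊗ powM B j) ≈ traceGain s j k + trace (powM B (k ℕ.+ j))
    trace-powM-⊗ zero j =
      trans (trace-cong {A = idM ⊗ powM B j} (λ i l → idM-∙ i _)) (sym (+-identityˡ _))
    trace-powM-⊗ (suc k) j = begin
      trace (powM A (suc k) ⊗ powM B j)
        ≈⟨ trace-cong {A = powM A (suc k) ⊗ powM B j} regroup ⟩
      trace ((X ⊗ Z) ⊕ (X ⊗ powM B (suc j)))
        ≈⟨ trace-⊕ (X ⊗ Z) (X ⊗ powM B (suc j)) ⟩
      trace (X ⊗ Z) + trace (X ⊗ powM B (suc j))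
        ≈⟨ +-cong (trans (trace-outer X (powM B j)) (passage-correct j k)) (trace-powM-⊗ k (suc j)) ⟩
      passage s j k + (traceGain s (suc j) k + trace (powM B (k ℕ.+ suc j)))
        ≈⟨ solve 3 (λ x y z → x :+ (y :+ z) := (y :+ x) :+ z) refl _ _ _ ⟩
      traceGain s j (suc k) + trace (powM B (k ℕ.+ suc j))
        ≡⟨ ≡.cong (λ m → traceGain s j (suc k) + trace (powM B m)) (ℕ.+-suc k j) ⟩
      traceGain s j (suc k) + trace (powM B (suc k ℕ.+ j)) ∎
      where
      X Z : Mat n
      X = powM A k
      Z i l = u i * (v ᵥ* powM B j) l
      regroup : (powM A (suc k) ⊗ powM B j) ≋ ((X ⊗ Z) ⊕ (X ⊗ powM B (suc j)))
      regroup i l = begin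
        (powM A (suc k) ⊗ powM B j) i l
          ≈⟨ ⊗-cong {B = powM B j} (powM-sucʳ A k) (λ _ _ → refl) i l ⟩
        ((X ⊗ A) ⊗ powM B j) i l
          ≈⟨ ⊗-assoc X A (powM B j) i l ⟩
        (X ⊗ (A ⊗ powM B j)) i l
          ≈⟨ ∙-cong {u = X i} (λ _ → refl) (λ m → *ᵥ-update (λ p → powM B j p l) m) ⟩
        X i ∙ (λ m → Z m l + powM B (suc j) m l)
          ≈⟨ ∙-distribˡ (X i) (λ m → Z m l) (λ m → powM B (suc j) m l) ⟩
        ((X ⊗ Z) ⊕ (X ⊗ powM B (suc j))) i l ∎

    trace-powM-8 : trace (powM A 8) ≈ traceGain s 0 8 + trace (powM B 8)
    trace-powM-8 =
      trans (trace-cong {A = powM A 8} (λ i j → sym (∙-idM j (powM A 8 i)))) (trace-powM-⊗ 8 0)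

    trace-update∈S₁ : InS₁mod8 (trace (powM B 8)) → InS₁mod8 (trace (powM A 8))
    trace-update∈S₁ B∈ = S₁-resp-≈ (sym trace-powM-8) (S₁-+ (traceGain₈∈S₁ s) B∈)

  -- Necessity, by induction on the number of rank-one summands

  trace-sumOuter∈S₁ : ∀ {n} r (us vs : Fin r → Vec n) →
    InS₁mod8 (trace (powM (sumM r (λ k → outer (us k) (vs k))) 8))
  trace-sumOuter∈S₁ {n} zero us vs =
    S₁-resp-≈ (sym (sumFin-0 n (λ i → powM-zeroM {n} i i))) S₁-0
  trace-sumOuter∈S₁ (suc r) us vs =
    trace-update∈S₁ {u = us zero} {vs zero} (λ _ _ → refl)
      (trace-sumOuter∈S₁ r (λ k → us (suc k)) (λ k → vs (suc k)))

  trace-powM-8∈S₁ : ∀ {n} (A : Mat n) → InS₁mod8 (trace (powM A 8))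
  trace-powM-8∈S₁ {n} A =
    S₁-resp-≈ (sym (trace-cong {A = powM A 8} (powM-cong 8 (sumM-columns A))))
      (trace-sumOuter∈S₁ n (λ k i → A i k) idM)

  trace-sumM∈S₁ : ∀ {n} r (Ms : Fin r → Mat n) → InS₁mod8 (trace (sumM r (λ k → powM (Ms k) 8)))
  trace-sumM∈S₁ {n} zero Ms = S₁-resp-≈ (sym (sumFin-0 n (λ i → refl))) S₁-0
  trace-sumM∈S₁ (suc r) Ms =
    S₁-resp-≈ (sym (trace-⊕ (powM (Ms zero) 8) (sumM r (λ k → powM (Ms (suc k)) 8))))
      (S₁-+ (trace-powM-8∈S₁ (Ms zero)) (trace-sumM∈S₁ r (λ k → Ms (suc k))))

  sumOfEighthPowers⇒trace∈S₁ : ∀ {n} (M : Mat n) → IsSumOfEighthPowers M → InS₁mod8 (trace M)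
  sumOfEighthPowers⇒trace∈S₁ M (r , Ms , M≋) =
    S₁-resp-≈ (sym (trace-cong {A = M} M≋)) (trace-sumM∈S₁ (suc r) Ms)

  -- The additive monoid of sums of eighth powers

  cons-eighthPower : ∀ {M : Mat n} A →
    IsSumOfEighthPowers M → IsSumOfEighthPowers (powM A 8 ⊕ M)
  cons-eighthPower A (r , Ms , M≋) =
    suc r , (λ { zero → A ; (suc k) → Ms k }) , λ i j → +-congˡ (M≋ i j)

  Sum⁸-resp-≋ : ∀ {M N : Mat n} → M ≋ N → IsSumOfEighthPowers M → IsSumOfEighthPowers N
  Sum⁸-resp-≋ M≋N (r , Ms , M≋) = r , Ms , λ i j → trans (sym (M≋N i j)) (M≋ i j)

  Sum⁸-⊕ : ∀ {M N : Mat n} →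
    IsSumOfEighthPowers M → IsSumOfEighthPowers N → IsSumOfEighthPowers (M ⊕ N)
  Sum⁸-⊕ {n} {M} {N} (r , Ms , M≋) N∈ =
    Sum⁸-resp-≋ (λ i j → +-congʳ (sym (M≋ i j))) (append r Ms)
    where
    append : ∀ r (Ms : Fin (suc r) → Mat n) →
      IsSumOfEighthPowers (sumM (suc r) (λ k → powM (Ms k) 8) ⊕ N)
    append zero Ms =
      Sum⁸-resp-≋ (λ i j → +-congʳ (sym (+-identityʳ _))) (cons-eighthPower (Ms zero) N∈)
    append (suc r) Ms =
      Sum⁸-resp-≋ (λ i j → sym (+-assoc _ _ _))
        (cons-eighthPower (Ms zero) (append r (λ k → Ms (suc k))))

  powM-8∈Sum⁸ : ∀ (A : Mat n) → IsSumOfEighthPowers (powM A 8)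
  powM-8∈Sum⁸ A = 0 , (λ _ → A) , λ i j → sym (+-identityʳ _)

  -- At least one summand is required, so zero is represented as 0⁸ and not as an empty sum.
  zeroM∈Sum⁸ : IsSumOfEighthPowers (zeroM {n})
  zeroM∈Sum⁸ {n} = Sum⁸-resp-≋ (powM-zeroM {n}) (powM-8∈Sum⁸ zeroM)

  sumM∈Sum⁸ : ∀ r (Ms : Fin r → Mat n) →
    (∀ k → IsSumOfEighthPowers (Ms k)) → IsSumOfEighthPowers (sumM r Ms)
  sumM∈Sum⁸ zero Ms Ms∈ = zeroM∈Sum⁸
  sumM∈Sum⁸ (suc r) Ms Ms∈ = Sum⁸-⊕ (Ms∈ zero) (sumM∈Sum⁸ r (λ k → Ms (suc k)) (λ k → Ms∈ (suc k)))

  -- The condition vᵀu = 1 makes u vᵀ idempotent.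
  outer∈Sum⁸ : ∀ (u v : Vec n) → v ∙ u ≈ 1# → IsSumOfEighthPowers (outer u v)
  outer∈Sum⁸ u v v∙u≈1 = Sum⁸-resp-≋ (powM-8 idem idem idem) (powM-8∈Sum⁸ (outer u v))
    where
    idem : (outer u v ⊗ outer u v) ≋ outer u v
    idem i j = begin
      (λ k → u i * v k) ∙ (λ k → u k * v j)    ≈⟨ ∙-scaleʳ (λ k → u i * v k) u (v j) ⟩
      (λ k → u i * v k) ∙ u * v j              ≈⟨ *-congʳ (∙-scaleˡ (u i) v u) ⟩
      u i * (v ∙ u) * v j                      ≈⟨ *-congʳ (trans (*-congˡ v∙u≈1) (*-identityʳ _)) ⟩
      u i * v j                                ∎

  -- Padded 2×2 blocks and multiples of e₀₀

  block : Carrier × Carrier × Carrier × Carrier → Mat (2 ℕ.+ n)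
  block (a , b , c , d) zero zero = a
  block (a , b , c , d) zero (suc zero) = b
  block (a , b , c , d) (suc zero) zero = c
  block (a , b , c , d) (suc zero) (suc zero) = d
  block _ _ _ = 0#

  open Square₂ _+_ _*_

  private
    module S {m} = Square₂ {A = Polynomial m} _:+_ _:*_

  block-square : ∀ x → (block {n} x ⊗ block x) ≋ block (square x)
  block-square {n} x@(a , b , c , d) = λ where
      zero zero → two a a b c zeros
      zero (suc zero) → two a b b d zeros
      zero (suc (suc j)) → null (block x zero) (λ k → block x k (suc (suc j))) right0
      (suc zero) zero → two c a d c zeros
      (suc zero) (suc zero) → two c b d d zeros
      (suc zero) (suc (suc j)) → null (block x (suc zero)) (λ k → block x k (suc (suc j))) right0
      (suc (suc i)) j → sumFin-0 (2 ℕ.+ n) {λ k → block x (suc (suc i)) k * block x k j} (λ k → zeroˡ _)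
    where
    two : ∀ p q p′ q′ {f : Fin n → Carrier} → (∀ k → f k ≈ 0#) →
      p * q + (p′ * q′ + sumFin n f) ≈ p * q + p′ * q′
    two p q p′ q′ f≈0 = +-congˡ (trans (+-congˡ (sumFin-0 n f≈0)) (+-identityʳ _))
    zeros : ∀ {y} (k : Fin n) → 0# * y ≈ 0#
    zeros k = zeroˡ _
    right0 : ∀ {j} k → block x k (suc (suc j)) ≈ 0#
    right0 zero = refl
    right0 (suc zero) = refl
    right0 (suc (suc k)) = refl
    null : ∀ (u v : Vec (2 ℕ.+ n)) → (∀ k → v k ≈ 0#) → u ∙ v ≈ 0#
    null u v v≈0 =
      sumFin-0 (2 ℕ.+ n) {λ k → u k * v k} (λ k → trans (*-congˡ {u k} (v≈0 k)) (zeroʳ _))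

  block-8 : ∀ x → powM (block {n} x) 8 ≋ block (square (square (square x)))
  block-8 x =
    powM-8 {A = block x} {block (square x)} {block (square (square x))}
      (block-square x) (block-square (square x)) (block-square (square (square x)))

  trace-block : ∀ a b c d → trace (block {n} (a , b , c , d)) ≈ a + d
  trace-block {n} a b c d =
    +-congˡ (trans (+-congˡ (sumFin-0 n (λ i → refl))) (+-identityʳ _))

  corner : Carrier → Mat (2 ℕ.+ n)
  corner t = block (t , 0# , 0# , 0#)

  -- This form is uniform in the indices, so later identities need no case split: the solver treats
  -- the entries of `idM` as variables.
  corner≋ : ∀ t (i j : Fin (2 ℕ.+ n)) → corner t i j ≈ t * idM zero i * idM zero j
  corner≋ t zero zero = sym (trans (*-identityʳ _) (*-identityʳ _))
  corner≋ t zero (suc zero) = sym (zeroʳ _)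
  corner≋ t zero (suc (suc j)) = sym (zeroʳ _)
  corner≋ t (suc zero) zero = sym (trans (*-identityʳ _) (zeroʳ _))
  corner≋ t (suc zero) (suc zero) = sym (zeroʳ _)
  corner≋ t (suc zero) (suc (suc j)) = sym (zeroʳ _)
  corner≋ t (suc (suc i)) j = sym (trans (*-congʳ (zeroʳ _)) (zeroˡ _))

  -- con (+ 1) denotes 1# + 0#, whereas this denotes 1# on the nose.
  private
    :1 : ∀ {m} → Polynomial m
    :1 = :nat 1 :^ 0

  -- As 2×2 matrices, `W` and `W′` satisfy X² + X + 1 = 0, so X⁸ = X² = -X - 1. Since W + W′ =
  -- -2e₁₁, their eighth powers add up to -2e₀₀, and adding the idempotent e₀₀ leaves -e₀₀.
  corner-1∈Sum⁸ : IsSumOfEighthPowers (corner {n} (- 1#))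
  corner-1∈Sum⁸ {n} =
    Sum⁸-resp-≋ sum≋
      (Sum⁸-⊕ (Sum⁸-⊕ (power W) (power W′)) (power (1# , 0# , 0# , 0#)))
    where
    W W′ : Carrier × Carrier × Carrier × Carrier
    W = 0# , 1# , - 1# , - 1#
    W′ = 0# , - 1# , 1# , - 1#
    power : ∀ x → IsSumOfEighthPowers (block {n} (square (square (square x))))
    power x = Sum⁸-resp-≋ (block-8 x) (powM-8∈Sum⁸ (block x))
    sum≋ : ((block (square (square (square W))) ⊕ block (square (square (square W′))))
              ⊕ block (square (square (square (1# , 0# , 0# , 0#))))) ≋ corner {n} (- 1#)
    sum≋ = λ where
        zero zero → solve 0 (:entry proj₁ := :- :1) refl
        zero (suc zero) → solve 0 (:entry (λ x → proj₁ (proj₂ x)) := :nat 0) refl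
        zero (suc (suc j)) → 0+0+0≈0
        (suc zero) zero → solve 0 (:entry (λ x → proj₁ (proj₂ (proj₂ x))) := :nat 0) refl
        (suc zero) (suc zero) → solve 0 (:entry (λ x → proj₂ (proj₂ (proj₂ x))) := :nat 0) refl
        (suc zero) (suc (suc j)) → 0+0+0≈0
        (suc (suc i)) j → 0+0+0≈0
      where
      :power : Polynomial 0 × Polynomial 0 × Polynomial 0 × Polynomial 0 →
        Polynomial 0 × Polynomial 0 × Polynomial 0 × Polynomial 0
      :power x = S.square (S.square (S.square x))
      :entry : (Polynomial 0 × Polynomial 0 × Polynomial 0 × Polynomial 0 → Polynomial 0) →
        Polynomial 0
      :entry π =
        π (:power (:nat 0 , :1 , :- :1 , :- :1))
          :+ π (:power (:nat 0 , :- :1 , :1 , :- :1))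
          :+ π (:power (:1 , :nat 0 , :nat 0 , :nat 0))
      0+0+0≈0 : 0# + 0# + 0# ≈ 0#
      0+0+0≈0 = trans (+-identityʳ _) (+-identityʳ _)

  -- x e_lᵀ − x_l e₀₀ is obtained from rank-one idempotents and −e₀₀.
  column-corner∈Sum⁸ : ∀ (x : Vec (2 ℕ.+ n)) l →
    IsSumOfEighthPowers (outer x (idM l) ⊕ corner (- x l))
  column-corner∈Sum⁸ {n} x l = go l
    where
    ε w : Vec (2 ℕ.+ n)
    ε = idM zero
    -- `w` is `x` with its entry at `zero` replaced by 1, so that εᵀw = 1.
    w i = x i + (1# - x zero) * ε i

    go : ∀ l → IsSumOfEighthPowers (outer x (idM l) ⊕ corner (- x l))
    go zero = Sum⁸-resp-≋
      (λ i j → trans (+-congˡ (corner≋ (- 1#) i j))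
        (trans
          (solve 4 (λ xᵢ x₀ d g →
              (xᵢ :+ (:1 :- x₀) :* d) :* g :+ :- :1 :* d :* g := xᵢ :* g :+ :- x₀ :* d :* g)
            refl (x i) (x zero) (ε i) (ε j))
          (+-congˡ (sym (corner≋ (- x zero) i j)))))
      (Sum⁸-⊕
        (outer∈Sum⁸ w ε (trans (idM-∙ zero w)
          (solve 1 (λ x₀ → x₀ :+ (:1 :- x₀) :* :1 := :1) refl (x zero))))
        corner-1∈Sum⁸)
    go (suc l) = Sum⁸-resp-≋
      (λ i j → trans (+-congˡ (corner≋ (- 1#) i j))
        (trans (+-congʳ (+-congˡ (corner≋ (- 1#) i j)))
        (trans (+-congʳ (+-congʳ (+-congˡ (corner≋ (- 1#) i j))))
        (trans
          (solve 6 (λ xᵢ x₀ xₗ d g f →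
              (xᵢ :+ (:1 :- x₀) :* d) :* (f :+ (:1 :- xₗ) :* g) :+ d :* (g :+ (x₀ :- :1) :* f)
                :+ (d :+ (:1 :- xₗ) :* (d :- (xᵢ :+ (:1 :- x₀) :* d))) :* g
                :+ :- :1 :* d :* g :+ :- :1 :* d :* g :+ :- :1 :* d :* g
            := xᵢ :* f :+ :- xₗ :* d :* g)
            refl (x i) (x zero) (x (suc l)) (ε i) (ε j) (φ j))
          (+-congˡ (sym (corner≋ (- x (suc l)) i j)))))))
      -- Writing xₗ for `x (suc l)`, w vᵀ = x φᵀ + (1 - x₀) ε φᵀ + (1 - xₗ) w εᵀ. The terms ε rᵀ and
      -- y εᵀ cancel the last two, leaving x φᵀ + (3 - xₗ)e₀₀, and three copies of -e₀₀ finish.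
      (Sum⁸-⊕ (Sum⁸-⊕ (Sum⁸-⊕ (Sum⁸-⊕ (Sum⁸-⊕
        (outer∈Sum⁸ w v v∙w≈1) (outer∈Sum⁸ ε r r∙ε≈1)) (outer∈Sum⁸ y ε ε∙y≈1))
        corner-1∈Sum⁸) corner-1∈Sum⁸) corner-1∈Sum⁸)
      where
      φ v r y : Vec (2 ℕ.+ n)
      φ = idM (suc l)
      -- The ε-part of `v` is chosen to give vᵀw = xₗ + (1 - xₗ) = 1. The corrections in `r` and `y`
      -- vanish at `zero`, which gives rᵀε = εᵀy = 1.
      v j = φ j + (1# - x (suc l)) * ε j
      r j = ε j + (x zero - 1#) * φ j
      y i = ε i + (1# - x (suc l)) * (ε i - w i)

      v∙w≈1 : v ∙ w ≈ 1#
      v∙w≈1 = begin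
        v ∙ w
          ≈⟨ ∙-distribʳ φ (λ j → (1# - x (suc l)) * ε j) w ⟩
        φ ∙ w + (λ j → (1# - x (suc l)) * ε j) ∙ w
          ≈⟨ +-cong (idM-∙ (suc l) w) (trans (∙-scaleˡ (1# - x (suc l)) ε w) (*-congˡ (idM-∙ zero w))) ⟩
        w (suc l) + (1# - x (suc l)) * w zero
          ≈⟨ solve 2 (λ x₀ xₗ →
               (xₗ :+ (:1 :- x₀) :* :nat 0) :+ (:1 :- xₗ) :* (x₀ :+ (:1 :- x₀) :* :1) := :1)
             refl (x zero) (x (suc l)) ⟩
        1# ∎

      r∙ε≈1 : r ∙ ε ≈ 1#
      r∙ε≈1 = begin
        r ∙ ε         ≈⟨ sumFin-cong (2 ℕ.+ n) (λ i → *-comm (r i) (ε i)) ⟩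
        ε ∙ r         ≈⟨ idM-∙ zero r ⟩
        r zero        ≈⟨ solve 1 (λ x₀ → :1 :+ (x₀ :- :1) :* :nat 0 := :1) refl (x zero) ⟩
        1#            ∎

      ε∙y≈1 : ε ∙ y ≈ 1#
      ε∙y≈1 = trans (idM-∙ zero y)
        (solve 2 (λ x₀ xₗ → :1 :+ (:1 :- xₗ) :* (:1 :- (x₀ :+ (:1 :- x₀) :* :1)) := :1)
          refl (x zero) (x (suc l)))

  -- Sufficiency: reduction to the trace

  corner-cong : ∀ {t u} → t ≈ u → corner {n} t ≋ corner u
  corner-cong {t = t} {u} t≈u i j =
    trans (corner≋ t i j) (trans (*-congʳ (*-congʳ t≈u)) (sym (corner≋ u i j)))

  corner-0 : corner {n} 0# ≋ zeroM
  corner-0 i j = trans (corner≋ 0# i j) (trans (*-congʳ (zeroˡ _)) (zeroˡ _))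

  corner-⊕ : ∀ t u → (corner {n} t ⊕ corner u) ≋ corner (t + u)
  corner-⊕ t u i j = begin
    corner t i j + corner u i j
      ≈⟨ +-cong (corner≋ t i j) (corner≋ u i j) ⟩
    t * idM zero i * idM zero j + u * idM zero i * idM zero j
      ≈⟨ trans (sym (distribʳ _ _ _)) (*-congʳ (sym (distribʳ _ _ _))) ⟩
    (t + u) * idM zero i * idM zero j
      ≈⟨ corner≋ (t + u) i j ⟨
    corner (t + u) i j ∎

  sumFin-corner : ∀ r (f : Fin r → Carrier) (i j : Fin (2 ℕ.+ n)) →
    sumFin r (λ k → corner (f k) i j) ≈ corner (sumFin r f) i j
  sumFin-corner zero f i j = sym (corner-0 i j)
  sumFin-corner (suc r) f i j =
    trans (+-congˡ (sumFin-corner r (λ k → f (suc k)) i j))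
      (corner-⊕ (f zero) (sumFin r (λ k → f (suc k))) i j)

  -- `column-corner∈Sum⁸` is summed over all columns; the corners collect the diagonal entries.
  traceless∈Sum⁸ : ∀ (M : Mat (2 ℕ.+ n)) → IsSumOfEighthPowers (M ⊕ corner (- trace M))
  traceless∈Sum⁸ {n} M = Sum⁸-resp-≋ sum≋ (sumM∈Sum⁸ m Ms (λ l → column-corner∈Sum⁸ (λ i → M i l) l))
    where
    m : ℕ
    m = 2 ℕ.+ n
    Ms : Fin m → Mat m
    Ms l = outer (λ i → M i l) (idM l) ⊕ corner (- M l l)
    sum≋ : sumM m Ms ≋ (M ⊕ corner (- trace M))
    sum≋ i j = begin
      sumM m Ms i j
        ≡⟨ sumM-entry m Ms i j ⟩
      sumFin m (λ l → M i l * idM l j + corner (- M l l) i j)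
        ≈⟨ sumFin-+ m (λ l → M i l * idM l j) (λ l → corner (- M l l) i j) ⟩
      sumFin m (λ l → M i l * idM l j) + sumFin m (λ l → corner (- M l l) i j)
        ≈⟨ +-cong (∙-idM j (M i)) (sumFin-corner m (λ l → - M l l) i j) ⟩
      M i j + corner (sumFin m (λ l → - M l l)) i j
        ≈⟨ +-congˡ (corner-cong (sumFin-neg m (λ l → M l l)) i j) ⟩
      M i j + corner (- trace M) i j ∎

  corner-trace∈Sum⁸⇒∈Sum⁸ : ∀ (M : Mat (2 ℕ.+ n)) →
    IsSumOfEighthPowers (corner {n} (trace M)) → IsSumOfEighthPowers M
  corner-trace∈Sum⁸⇒∈Sum⁸ M tr∈ = Sum⁸-resp-≋ sum≋ (Sum⁸-⊕ (traceless∈Sum⁸ M) tr∈)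
    where
    sum≋ : ((M ⊕ corner (- trace M)) ⊕ corner (trace M)) ≋ M
    sum≋ i j = begin
      M i j + corner (- trace M) i j + corner (trace M) i j
        ≈⟨ +-assoc _ _ _ ⟩
      M i j + (corner (- trace M) i j + corner (trace M) i j)
        ≈⟨ +-congˡ (corner-⊕ (- trace M) (trace M) i j) ⟩
      M i j + corner (- trace M + trace M) i j
        ≈⟨ +-congˡ (trans (corner-cong (-‿inverseˡ (trace M)) i j) (corner-0 i j)) ⟩
      M i j + 0#
        ≈⟨ +-identityʳ _ ⟩
      M i j ∎

  -- `traceless∈Sum⁸` applied to -A⁸ gives -A⁸ + Tr(A⁸)e₀₀; adding A⁸ leaves the corner.
  corner-trace-powM-8∈Sum⁸ : ∀ (A : Mat (2 ℕ.+ n)) →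
    IsSumOfEighthPowers (corner {n} (trace (powM A 8)))
  corner-trace-powM-8∈Sum⁸ {n} A = Sum⁸-resp-≋ sum≋ (Sum⁸-⊕ (powM-8∈Sum⁸ A) (traceless∈Sum⁸ N))
    where
    N : Mat (2 ℕ.+ n)
    N i j = - powM A 8 i j
    sum≋ : (powM A 8 ⊕ (N ⊕ corner (- trace N))) ≋ corner (trace (powM A 8))
    sum≋ i j = begin
      powM A 8 i j + (- powM A 8 i j + corner (- trace N) i j)
        ≈⟨ +-assoc _ _ _ ⟨
      powM A 8 i j - powM A 8 i j + corner (- trace N) i j
        ≈⟨ trans (+-congʳ (-‿inverseʳ _)) (+-identityˡ _) ⟩
      corner (- trace N) i j
        ≈⟨ corner-cong (trans (-‿cong (sumFin-neg (2 ℕ.+ n) (λ k → powM A 8 k k))) (-‿involutive _)) i j ⟩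
      corner (trace (powM A 8)) i j ∎

  -- The block is a companion matrix of t² - at - b. Both sides are explicit polynomials in a and b,
  -- compared by the solver.
  trace₂≈trace-powM-8 : ∀ a b → trace (powM (block {n} (a , b , 1# , 0#)) 8) ≈ trace₂ a b
  trace₂≈trace-powM-8 {n} a b = begin
    trace (powM (block {n} (a , b , 1# , 0#)) 8)
      ≈⟨ trace-cong {A = powM (block {n} (a , b , 1# , 0#)) 8} (block-8 (a , b , 1# , 0#)) ⟩
    trace (block {n} x⁸)
      ≈⟨ trace-block {n} (proj₁ x⁸) (proj₁ (proj₂ x⁸)) (proj₁ (proj₂ (proj₂ x⁸))) (proj₂ (proj₂ (proj₂ x⁸))) ⟩
    proj₁ x⁸ + proj₂ (proj₂ (proj₂ x⁸))
      ≈⟨ solve 2 (λ a b →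
           (let :x⁸ = S.square (S.square (S.square (a , b , :1 , :nat 0)))
            in proj₁ :x⁸ :+ proj₂ (proj₂ (proj₂ :x⁸))) := :trace₂ a b) refl a b ⟩
    trace₂ a b ∎
    where
    x⁸ : Carrier × Carrier × Carrier × Carrier
    x⁸ = square (square (square (a , b , 1# , 0#)))

  -- The set T of the additive argument consists of those t for which t e₀₀ is a sum of eighth
  -- powers.
  trace∈S₁⇒sumOfEighthPowers : ∀ (M : Mat (2 ℕ.+ n)) →
    InS₁mod8 (trace M) → IsSumOfEighthPowers M
  trace∈S₁⇒sumOfEighthPowers {n} M tr∈ = corner-trace∈Sum⁸⇒∈Sum⁸ M (S₁⊆ tr∈)
    where
    open AdditiveClosure (λ t → IsSumOfEighthPowers (corner {n} t))
      (λ t≈u → Sum⁸-resp-≋ (corner-cong t≈u))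
      (Sum⁸-resp-≋ (λ i j → sym (corner-0 i j)) zeroM∈Sum⁸)
      (λ t∈ u∈ → Sum⁸-resp-≋ (corner-⊕ _ _) (Sum⁸-⊕ t∈ u∈))
      (λ a b → Sum⁸-resp-≋ (corner-cong (trace₂≈trace-powM-8 {n} a b))
        (corner-trace-powM-8∈Sum⁸ (block (a , b , 1# , 0#))))

theorem4p3 : ∀ {c ℓ} (R : CommutativeRing c ℓ) (n : ℕ) → 2 ≤ n →
  (M : MatrixDefs.Mat R n) →
  (MatrixDefs.IsSumOfEighthPowers R M → MatrixDefs.InS₁mod8 R (MatrixDefs.trace R M))
  × (MatrixDefs.InS₁mod8 R (MatrixDefs.trace R M) → MatrixDefs.IsSumOfEighthPowers R M)
theorem4p3 R (suc (suc n)) (s≤s (s≤s z≤n)) M =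
  sumOfEighthPowers⇒trace∈S₁ M , trace∈S₁⇒sumOfEighthPowers M
  where open EighthPowers R
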